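{- For every integer $k\ge1$, \[s_{k^k}(A)=s_{(k-1)^k}(A)=(-q)^{\binom{k}{2}},\] that is, $\det\big(C_{k-i+j}(q)\big)_{1\le i,j\le k}=\det\big(C_{k-1-i+j}(q)\big)_{1\le i,j\le k}=(-q)^{k(k-1)/2}$.
   Context: $q$ is an indeterminate. The Narayana polynomials are $C_0(q)=1$ and $C_n(q)=\sum_{k=1}^n \frac1n\binom{n}{k-1}\binom{n}{k}q^{k-1}$ for $n\ge1$. The "Narayana alphabet" $A$ is the specialization of the ring of symmetric functions (over $\mathbb{Q}$) to $\mathbb{Q}[q]$ sending the complete symmetric function $h_n$ to $h_n(A)=C_n(q)$ for all $n\ge0$ (and $h_n(A)=0$ for $n<0$). For a partition $\lambda$, $s_\lambda(A)$ is the image of the Schur function, given by the Jacobi–Trudi formula $s_\lambda(A)=\det\big(h_{\lambda_i-i+j}(A)\big)_{1\le i,j\le \ell}$ for $\ell\ge$ the length of $\lambda$. Here $k^k$ is the partition with $k$ parts equal to $k$ and $(k-1)^k$ the partition with $k$ parts equal to $k-1$. -}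

module Defs where

open import Data.Nat as ℕ using (ℕ; zero; suc)
open import Data.Nat.Combinatorics using (_C_)
open import Data.Integer as ℤ using (ℤ; +_; -[1+_])
open import Data.Rational as ℚ using (ℚ; 0ℚ; 1ℚ)
open import Data.Fin as Fin using (Fin; toℕ; punchIn)
open import Data.Vec as Vec using (Vec; lookup; replicate)
open import Data.Bool using (if_then_else_)
open import Relation.Binary.PropositionalEquality using (_≡_)

-- Polynomials in q over ℚ, represented by their coefficient sequences
-- (coefficient of q^d at index d).  Equality is pointwise (see _≈_).
Poly : Set
Poly = ℕ → ℚ

_≈_ : Poly → Poly → Set
f ≈ g = ∀ d → f d ≡ g d

sumℚ : (n : ℕ) → (ℕ → ℚ) → ℚ
sumℚ zero    f = 0ℚ
sumℚ (suc n) f = sumℚ n f ℚ.+ f n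

0P : Poly
0P _ = 0ℚ

1P : Poly
1P zero    = 1ℚ
1P (suc _) = 0ℚ

qP : Poly
qP 1 = 1ℚ
qP _ = 0ℚ

_+P_ : Poly → Poly → Poly
(f +P g) d = f d ℚ.+ g d

-P_ : Poly → Poly
(-P f) d = ℚ.- f d

_*P_ : Poly → Poly → Poly
(f *P g) d = sumℚ (suc d) (λ i → f i ℚ.* g (d ℕ.∸ i))

_^P_ : Poly → ℕ → Poly
f ^P zero  = 1P
f ^P suc n = f *P (f ^P n)

sumP : (n : ℕ) → (Fin n → Poly) → Poly
sumP zero    f = 0P
sumP (suc n) f = f Fin.zero +P sumP n (λ j → f (Fin.suc j))

signP : ℕ → Poly → Poly
signP zero          f = f
signP (suc zero)    f = -P f
signP (suc (suc j)) f = signP j f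

det : (n : ℕ) → (Fin n → Fin n → Poly) → Poly
det zero    M = 1P
det (suc n) M =
  sumP (suc n) (λ j → signP (toℕ j)
    (M Fin.zero j *P det n (λ i l → M (Fin.suc i) (punchIn j l))))

-- Narayana polynomials: C_0 = 1, and for n ≥ 1
-- C_n(q) = ∑_{k=1}^n (1/n) binom(n,k-1) binom(n,k) q^{k-1};
-- coefficient of q^d (d = k-1) is (1/n) binom(n,d) binom(n,d+1)
-- (which vanishes automatically for d ≥ n).
Narayana : ℕ → Poly
Narayana zero    = 1P
Narayana (suc m) d = (+ ((suc m C d) ℕ.* (suc m C suc d))) ℚ./ suc m

hA : ℤ → Poly
hA (+ n)    = Narayana n
hA -[1+ _ ] = 0P

-- Schur function of a partition λ = (λ_1,…,λ_ℓ) (given as a vector of its ℓ parts,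
-- possibly padded with zeros) in the Narayana alphabet, via Jacobi–Trudi:
-- s_λ(A) = det (h_{λ_i - i + j}(A))_{1≤i,j≤ℓ}.
-- With 0-based indices i,j the index λ_i - i + j is unchanged.
sA : {ℓ : ℕ} → Vec ℕ ℓ → Poly
sA {ℓ} λ′ = det ℓ (λ i j → hA ((+ lookup λ′ i ℤ.- + toℕ i) ℤ.+ + toℕ j))

rect : (k a : ℕ) → Vec ℕ k
rect k a = replicate k a

{-# OPTIONS --safe #-}
module Submission where

open import Defs
open import Algebra.Bundles using (CommutativeRing)
import Algebra.Properties.Ring as RingProperties
import Algebra.Solver.Ring.NaturalCoefficients.Default as SemiringSolver
open import Data.Fin using (Fin; zero; suc; toℕ; punchIn; lift; fromℕ; inject₁)
import Data.Fin.Properties as Finₚ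
import Data.Integer as ℤ
import Data.Integer.Tactic.RingSolver as ℤ-RingSolver
import Data.Integer.Properties as ℤₚ
open import Data.Nat as ℕ using (ℕ; zero; suc; _<_; _≥_; _∸_; s≤s; z≤n)
open import Data.Nat.Combinatorics using (_C_; nC1≡n; nCk+nC[k+1]≡[n+1]C[k+1])
import Data.Nat.Properties as ℕₚ
import Data.Nat.Tactic.RingSolver as ℕ-RingSolver
open import Data.Product using (_,_; ∃-syntax; _×_)
open import Data.Rational as ℚ using (ℚ; 0ℚ; 1ℚ; ½)
import Data.Rational.Properties as ℚₚ
import Data.Rational.Solver as ℚ-Solver
import Data.Rational.Unnormalised as ℚᵘ
import Data.Rational.Unnormalised.Properties as ℚᵘₚ
open import Data.Sum using (inj₁; inj₂)
open import Data.Vec using (lookup)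
open import Data.Vec.Functional using (_∷_)
open import Data.Vec.Properties using (lookup-replicate)
open import Function using (_∘_)
open import Level using (0ℓ)
import Relation.Binary.Reasoning.Setoid as SetoidReasoning
open import Relation.Binary.PropositionalEquality
  using (_≡_; _≗_; refl; sym; trans; cong; cong₂; subst; module ≡-Reasoning)
open ℚ-Solver.+-*-Solver using (_:=_; _:+_; _:*_) renaming (solve to ℚsolve)
open ≡-Reasoning

-- With its rows reversed, the Jacobi–Trudi matrix of a rectangle is the Hankel matrix of the
-- moments C_{n+1} (for k^k) or C_n (for (k-1)^k).  These moments count weighted Motzkin paths
-- with down steps of weight q; let A(j, m) be the generating function of the paths of j steps
-- from height 0 to height m, so that A(j, m) = 0 for j < m and A(m, m) = 1.  The recurrence for
-- A shows that row m of the Hankel matrix is, modulo the rows 0, …, m-1, the row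
-- (q^m A(j, m))_j.  In the matrix of size m+1 this row comes first and only its last entry q^m
-- is nonzero, so the determinant of size m+1 is (-q)^m times the one of size m.
-- That A(n, 0) = C_{n+1} for level steps of weight 1 + q follows from the reflection formula
-- [q^d] A(n, k) = binom(n, d) binom(n, d+k) - binom(n, d-1) binom(n, d+k+1).

-- The commutative ring of polynomials

-- A record around _≈_, so that both polynomials can be inferred from an equation.
infix 4 _≋_
record _≋_ (f g : Poly) : Set where
  constructor mk
  field at : f ≈ g
open _≋_

tail : Poly → Poly
tail f d = f (suc d)

sumℚ-cong : ∀ n {f g} → f ≈ g → sumℚ n f ≡ sumℚ n g
sumℚ-cong zero    e = refl
sumℚ-cong (suc n) e = cong₂ ℚ._+_ (sumℚ-cong n e) (e n)

sumℚ-suc : ∀ n f → sumℚ (suc n) f ≡ f 0 ℚ.+ sumℚ n (tail f)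
sumℚ-suc zero    f = ℚₚ.+-comm 0ℚ (f 0)
sumℚ-suc (suc n) f = trans (cong (ℚ._+ f (suc n)) (sumℚ-suc n f)) (ℚₚ.+-assoc (f 0) (sumℚ n (tail f)) (f (suc n)))

*P-head : ∀ f g → (f *P g) 0 ≡ f 0 ℚ.* g 0
*P-head f g = ℚₚ.+-identityˡ (f 0 ℚ.* g 0)

-- Writing f as its constant term plus q times `tail f` makes the convolution recursive in the
-- degree, so the ring laws below are inductions on the degree and no double sum has to be
-- rearranged.
*P-tail : ∀ f g d → (f *P g) (suc d) ≡ f 0 ℚ.* g (suc d) ℚ.+ (tail f *P g) d
*P-tail f g d = sumℚ-suc (suc d) _

-- The mirror image of `*P-tail`, splitting the second factor; comparing the two gives
-- commutativity.
*P-tailʳ : ∀ f g d → (f *P g) (suc d) ≡ (f *P tail g) d ℚ.+ f (suc d) ℚ.* g 0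
*P-tailʳ f g zero = begin
  (f *P g) 1                                          ≡⟨ *P-tail f g 0 ⟩
  f 0 ℚ.* g 1 ℚ.+ (tail f *P g) 0                     ≡⟨ cong₂ ℚ._+_ (sym (*P-head f (tail g))) (*P-head (tail f) g) ⟩
  (f *P tail g) 0 ℚ.+ f 1 ℚ.* g 0                     ∎
*P-tailʳ f g (suc d) = begin
  (f *P g) (2 ℕ.+ d)                                  ≡⟨ *P-tail f g (suc d) ⟩
  f 0 ℚ.* g (2 ℕ.+ d) ℚ.+ (tail f *P g) (suc d)
    ≡⟨ cong (f 0 ℚ.* g (2 ℕ.+ d) ℚ.+_) (*P-tailʳ (tail f) g d) ⟩
  f 0 ℚ.* g (2 ℕ.+ d) ℚ.+ ((tail f *P tail g) d ℚ.+ f (2 ℕ.+ d) ℚ.* g 0)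
    ≡⟨ ℚₚ.+-assoc (f 0 ℚ.* g (2 ℕ.+ d)) ((tail f *P tail g) d) (f (2 ℕ.+ d) ℚ.* g 0) ⟨
  (f 0 ℚ.* g (2 ℕ.+ d) ℚ.+ (tail f *P tail g) d) ℚ.+ f (2 ℕ.+ d) ℚ.* g 0
    ≡⟨ cong (ℚ._+ f (2 ℕ.+ d) ℚ.* g 0) (*P-tail f (tail g) d) ⟨
  (f *P tail g) (suc d) ℚ.+ f (2 ℕ.+ d) ℚ.* g 0       ∎

*P-cong : ∀ {f f′ g g′} → f ≈ f′ → g ≈ g′ → (f *P g) ≈ (f′ *P g′)
*P-cong e e′ d = sumℚ-cong (suc d) (λ i → cong₂ ℚ._*_ (e i) (e′ (d ℕ.∸ i)))

*P-comm : ∀ f g → (f *P g) ≈ (g *P f)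
*P-comm f g zero    = trans (*P-head f g) (trans (ℚₚ.*-comm (f 0) (g 0)) (sym (*P-head g f)))
*P-comm f g (suc d) = begin
  (f *P g) (suc d)                               ≡⟨ *P-tail f g d ⟩
  f 0 ℚ.* g (suc d) ℚ.+ (tail f *P g) d          ≡⟨ cong₂ ℚ._+_ (ℚₚ.*-comm (f 0) (g (suc d))) (*P-comm (tail f) g d) ⟩
  g (suc d) ℚ.* f 0 ℚ.+ (g *P tail f) d          ≡⟨ ℚₚ.+-comm (g (suc d) ℚ.* f 0) ((g *P tail f) d) ⟩
  (g *P tail f) d ℚ.+ g (suc d) ℚ.* f 0          ≡⟨ *P-tailʳ g f d ⟨
  (g *P f) (suc d)                               ∎

*P-distribʳ : ∀ h f g → ((f +P g) *P h) ≈ ((f *P h) +P (g *P h))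
*P-distribʳ h f g zero = begin
  ((f +P g) *P h) 0                    ≡⟨ *P-head (f +P g) h ⟩
  (f 0 ℚ.+ g 0) ℚ.* h 0                ≡⟨ ℚₚ.*-distribʳ-+ (h 0) (f 0) (g 0) ⟩
  f 0 ℚ.* h 0 ℚ.+ g 0 ℚ.* h 0          ≡⟨ cong₂ ℚ._+_ (*P-head f h) (*P-head g h) ⟨
  ((f *P h) +P (g *P h)) 0             ∎
*P-distribʳ h f g (suc d) = begin
  ((f +P g) *P h) (suc d)
    ≡⟨ *P-tail (f +P g) h d ⟩
  (f 0 ℚ.+ g 0) ℚ.* h (suc d) ℚ.+ ((tail f +P tail g) *P h) d
    ≡⟨ cong ((f 0 ℚ.+ g 0) ℚ.* h (suc d) ℚ.+_) (*P-distribʳ h (tail f) (tail g) d) ⟩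
  (f 0 ℚ.+ g 0) ℚ.* h (suc d) ℚ.+ ((tail f *P h) d ℚ.+ (tail g *P h) d)
    ≡⟨ ℚsolve 5 (λ a b c x y → (a :+ b) :* c :+ (x :+ y) := (a :* c :+ x) :+ (b :* c :+ y)) refl
         (f 0) (g 0) (h (suc d)) ((tail f *P h) d) ((tail g *P h) d) ⟩
  (f 0 ℚ.* h (suc d) ℚ.+ (tail f *P h) d) ℚ.+ (g 0 ℚ.* h (suc d) ℚ.+ (tail g *P h) d)
    ≡⟨ cong₂ ℚ._+_ (*P-tail f h d) (*P-tail g h d) ⟨
  ((f *P h) +P (g *P h)) (suc d) ∎

scale-*P : ∀ a f h d → ((λ e → a ℚ.* f e) *P h) d ≡ a ℚ.* (f *P h) d
scale-*P a f h zero = begin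
  ((λ e → a ℚ.* f e) *P h) 0     ≡⟨ *P-head (λ e → a ℚ.* f e) h ⟩
  (a ℚ.* f 0) ℚ.* h 0            ≡⟨ ℚₚ.*-assoc a (f 0) (h 0) ⟩
  a ℚ.* (f 0 ℚ.* h 0)            ≡⟨ cong (a ℚ.*_) (*P-head f h) ⟨
  a ℚ.* (f *P h) 0               ∎
scale-*P a f h (suc d) = begin
  ((λ e → a ℚ.* f e) *P h) (suc d)
    ≡⟨ *P-tail (λ e → a ℚ.* f e) h d ⟩
  (a ℚ.* f 0) ℚ.* h (suc d) ℚ.+ ((λ e → a ℚ.* tail f e) *P h) d
    ≡⟨ cong₂ ℚ._+_ (ℚₚ.*-assoc a (f 0) (h (suc d))) (scale-*P a (tail f) h d) ⟩
  a ℚ.* (f 0 ℚ.* h (suc d)) ℚ.+ a ℚ.* (tail f *P h) d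
    ≡⟨ ℚₚ.*-distribˡ-+ a (f 0 ℚ.* h (suc d)) ((tail f *P h) d) ⟨
  a ℚ.* (f 0 ℚ.* h (suc d) ℚ.+ (tail f *P h) d)
    ≡⟨ cong (a ℚ.*_) (*P-tail f h d) ⟨
  a ℚ.* (f *P h) (suc d) ∎

*P-assoc : ∀ f g h → ((f *P g) *P h) ≈ (f *P (g *P h))
*P-assoc f g h zero = begin
  ((f *P g) *P h) 0              ≡⟨ *P-head (f *P g) h ⟩
  (f *P g) 0 ℚ.* h 0             ≡⟨ cong (ℚ._* h 0) (*P-head f g) ⟩
  (f 0 ℚ.* g 0) ℚ.* h 0          ≡⟨ ℚₚ.*-assoc (f 0) (g 0) (h 0) ⟩
  f 0 ℚ.* (g 0 ℚ.* h 0)          ≡⟨ cong (f 0 ℚ.*_) (*P-head g h) ⟨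
  f 0 ℚ.* (g *P h) 0             ≡⟨ *P-head f (g *P h) ⟨
  (f *P (g *P h)) 0              ∎
*P-assoc f g h (suc d) = begin
  ((f *P g) *P h) (suc d)
    ≡⟨ *P-tail (f *P g) h d ⟩
  (f *P g) 0 ℚ.* h (suc d) ℚ.+ (tail (f *P g) *P h) d
    ≡⟨ cong₂ ℚ._+_ (cong (ℚ._* h (suc d)) (*P-head f g)) (*P-cong {g = h} (*P-tail f g) (λ _ → refl) d) ⟩
  (f 0 ℚ.* g 0) ℚ.* h (suc d) ℚ.+ (((λ e → f 0 ℚ.* tail g e) +P (tail f *P g)) *P h) d
    ≡⟨ cong ((f 0 ℚ.* g 0) ℚ.* h (suc d) ℚ.+_) (*P-distribʳ h (λ e → f 0 ℚ.* tail g e) (tail f *P g) d) ⟩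
  (f 0 ℚ.* g 0) ℚ.* h (suc d) ℚ.+ (((λ e → f 0 ℚ.* tail g e) *P h) d ℚ.+ ((tail f *P g) *P h) d)
    ≡⟨ cong ((f 0 ℚ.* g 0) ℚ.* h (suc d) ℚ.+_) (cong₂ ℚ._+_ (scale-*P (f 0) (tail g) h d) (*P-assoc (tail f) g h d)) ⟩
  (f 0 ℚ.* g 0) ℚ.* h (suc d) ℚ.+ (f 0 ℚ.* (tail g *P h) d ℚ.+ (tail f *P (g *P h)) d)
    ≡⟨ ℚsolve 5 (λ a b c x y → (a :* b) :* c :+ (a :* x :+ y) := a :* (b :* c :+ x) :+ y) refl
         (f 0) (g 0) (h (suc d)) ((tail g *P h) d) ((tail f *P (g *P h)) d) ⟩
  f 0 ℚ.* (g 0 ℚ.* h (suc d) ℚ.+ (tail g *P h) d) ℚ.+ (tail f *P (g *P h)) d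
    ≡⟨ cong (λ t → f 0 ℚ.* t ℚ.+ (tail f *P (g *P h)) d) (*P-tail g h d) ⟨
  f 0 ℚ.* (g *P h) (suc d) ℚ.+ (tail f *P (g *P h)) d
    ≡⟨ *P-tail f (g *P h) d ⟨
  (f *P (g *P h)) (suc d) ∎

0P-*P : ∀ f → (0P *P f) ≈ 0P
0P-*P f zero    = trans (*P-head 0P f) (ℚₚ.*-zeroˡ (f 0))
0P-*P f (suc d) = trans (*P-tail 0P f d) (cong₂ ℚ._+_ (ℚₚ.*-zeroˡ (f (suc d))) (0P-*P f d))

1P-*P : ∀ f → (1P *P f) ≈ f
1P-*P f zero    = trans (*P-head 1P f) (ℚₚ.*-identityˡ (f 0))
1P-*P f (suc d) = begin
  (1P *P f) (suc d)                          ≡⟨ *P-tail 1P f d ⟩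
  1ℚ ℚ.* f (suc d) ℚ.+ (0P *P f) d           ≡⟨ cong₂ ℚ._+_ (ℚₚ.*-identityˡ (f (suc d))) (0P-*P f d) ⟩
  f (suc d) ℚ.+ 0ℚ                           ≡⟨ ℚₚ.+-identityʳ (f (suc d)) ⟩
  f (suc d)                                  ∎

qP-*P-zero : ∀ f → (qP *P f) 0 ≡ 0ℚ
qP-*P-zero f = trans (*P-head qP f) (ℚₚ.*-zeroˡ (f 0))

qP-*P-suc : ∀ f d → (qP *P f) (suc d) ≡ f d
qP-*P-suc f d = begin
  (qP *P f) (suc d)                          ≡⟨ *P-tail qP f d ⟩
  0ℚ ℚ.* f (suc d) ℚ.+ (tail qP *P f) d      ≡⟨ cong₂ ℚ._+_ (ℚₚ.*-zeroˡ (f (suc d))) (*P-cong {g = f} tail-qP (λ _ → refl) d) ⟩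
  0ℚ ℚ.+ (1P *P f) d                         ≡⟨ ℚₚ.+-identityˡ ((1P *P f) d) ⟩
  (1P *P f) d                                ≡⟨ 1P-*P f d ⟩
  f d                                        ∎
  where
  tail-qP : tail qP ≈ 1P
  tail-qP zero    = refl
  tail-qP (suc _) = refl

-- Multiplication by ½ is available over ℚ. This is what turns antisymmetry of the determinant into
-- vanishing on equal rows.
x+x≋0⇒x≋0 : ∀ {f} → f +P f ≋ 0P → f ≋ 0P
x+x≋0⇒x≋0 {f} e = mk λ d → begin
  f d                            ≡⟨ ℚₚ.*-identityˡ (f d) ⟨
  1ℚ ℚ.* f d                     ≡⟨ ℚₚ.*-distribʳ-+ (f d) ½ ½ ⟩
  ½ ℚ.* f d ℚ.+ ½ ℚ.* f d        ≡⟨ ℚₚ.*-distribˡ-+ ½ (f d) (f d) ⟨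
  ½ ℚ.* (f d ℚ.+ f d)            ≡⟨ cong (½ ℚ.*_) (at e d) ⟩
  ½ ℚ.* 0ℚ                       ≡⟨ ℚₚ.*-zeroʳ ½ ⟩
  0ℚ                             ∎

polyRing : CommutativeRing 0ℓ 0ℓ
polyRing = record
  { Carrier = Poly ; _≈_ = _≋_ ; _+_ = _+P_ ; _*_ = _*P_ ; -_ = -P_ ; 0# = 0P ; 1# = 1P
  ; isCommutativeRing = record
    { isRing = record
      { +-isAbelianGroup = record
        { isGroup = record
          { isMonoid = record
            { isSemigroup = record
              { isMagma = record
                { isEquivalence = record
                  { refl  = mk (λ _ → refl)
                  ; sym   = λ e → mk (λ d → sym (at e d))
                  ; trans = λ e e′ → mk (λ d → trans (at e d) (at e′ d)) }
                ; ∙-cong = λ e e′ → mk (λ d → cong₂ ℚ._+_ (at e d) (at e′ d)) }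
              ; assoc = λ f g h → mk (λ d → ℚₚ.+-assoc (f d) (g d) (h d)) }
            ; identity = (λ f → mk (λ d → ℚₚ.+-identityˡ (f d))) , (λ f → mk (λ d → ℚₚ.+-identityʳ (f d))) }
          ; inverse = (λ f → mk (λ d → ℚₚ.+-inverseˡ (f d))) , (λ f → mk (λ d → ℚₚ.+-inverseʳ (f d)))
          ; ⁻¹-cong = λ e → mk (λ d → cong ℚ.-_ (at e d)) }
        ; comm = λ f g → mk (λ d → ℚₚ.+-comm (f d) (g d)) }
      ; *-cong = λ e e′ → mk (*P-cong (at e) (at e′))
      ; *-assoc = λ f g h → mk (*P-assoc f g h)
      ; *-identity = (λ f → mk (1P-*P f)) , (λ f → mk (λ d → trans (*P-comm f 1P d) (1P-*P f d)))
      ; distrib = (λ h f g → mk (λ d → begin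
          (h *P (f +P g)) d           ≡⟨ *P-comm h (f +P g) d ⟩
          ((f +P g) *P h) d           ≡⟨ *P-distribʳ h f g d ⟩
          (f *P h) d ℚ.+ (g *P h) d   ≡⟨ cong₂ ℚ._+_ (*P-comm f h d) (*P-comm g h d) ⟩
          (h *P f) d ℚ.+ (h *P g) d   ∎))
        , (λ h f g → mk (*P-distribʳ h f g)) }
    ; *-comm = λ f g → mk (*P-comm f g) } }

open CommutativeRing polyRing
  using ( _+_; _*_; -_; 0#; 1#; setoid; ring; commutativeSemiring; reflexive
        ; +-cong; +-congˡ; +-congʳ; *-cong; *-congˡ; *-congʳ; +-identityˡ; +-identityʳ
        ; *-identityˡ; *-identityʳ; *-assoc; zeroˡ; zeroʳ; distribˡ; -‿inverseʳ )
  renaming (refl to ≋-refl; sym to ≋-sym; trans to ≋-trans)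
open RingProperties ring using (-1*x≈-x; -‿involutive)
open SemiringSolver commutativeSemiring
  using (con) renaming (solve to psolve; _:+_ to _⊕_; _:*_ to _⊗_; _:=_ to _⊜_)
open SetoidReasoning setoid
  using (step-≈-⟩; step-≈-⟨) renaming (begin_ to begin≋_; _∎ to _∎≋)

-- Finite sums and signs

Row : ℕ → Set
Row n = Fin n → Poly

Matrix : ℕ → Set
Matrix n = Fin n → Row n

sumP-cong : ∀ n {f g : Row n} → (∀ j → f j ≋ g j) → sumP n f ≋ sumP n g
sumP-cong zero    e = ≋-refl
sumP-cong (suc n) e = +-cong (e zero) (sumP-cong n (e ∘ suc))

sumP-+ : ∀ n (f g : Row n) → sumP n (λ j → f j + g j) ≋ sumP n f + sumP n g
sumP-+ zero    f g = ≋-sym (+-identityˡ 0#)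
sumP-+ (suc n) f g = begin≋
  (f zero + g zero) + sumP n (λ j → f (suc j) + g (suc j))
    ≈⟨ +-congˡ {f zero + g zero} (sumP-+ n (f ∘ suc) (g ∘ suc)) ⟩
  (f zero + g zero) + (sumP n (f ∘ suc) + sumP n (g ∘ suc))
    ≈⟨ psolve 4 (λ a b c d → (a ⊕ b) ⊕ (c ⊕ d) ⊜ (a ⊕ c) ⊕ (b ⊕ d)) ≋-refl
         (f zero) (g zero) (sumP n (f ∘ suc)) (sumP n (g ∘ suc)) ⟩
  sumP (suc n) f + sumP (suc n) g ∎≋

sumP-* : ∀ n a (f : Row n) → sumP n (λ j → a * f j) ≋ a * sumP n f
sumP-* zero    a f = ≋-sym (zeroʳ a)
sumP-* (suc n) a f = begin≋
  a * f zero + sumP n (λ j → a * f (suc j))     ≈⟨ +-congˡ {a * f zero} (sumP-* n a (f ∘ suc)) ⟩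
  a * f zero + a * sumP n (f ∘ suc)             ≈⟨ distribˡ a (f zero) (sumP n (f ∘ suc)) ⟨
  a * sumP (suc n) f                            ∎≋

sumP-0 : ∀ n {f : Row n} → (∀ j → f j ≋ 0#) → sumP n f ≋ 0#
sumP-0 zero    e = ≋-refl
sumP-0 (suc n) e = ≋-trans (+-cong (e zero) (sumP-0 n (e ∘ suc))) (+-identityˡ 0#)

sumP-last : ∀ n {f : Row (suc n)} → (∀ j → f (inject₁ j) ≋ 0#) → sumP (suc n) f ≋ f (fromℕ n)
sumP-last zero    {f} e = +-identityʳ (f zero)
sumP-last (suc n) {f} e = ≋-trans (+-cong (e zero) (sumP-last n {f ∘ suc} (e ∘ suc))) (+-identityˡ (f (fromℕ (suc n))))

-- The sign as a ring element: the semiring solver knows no negation, so it treats `ε` as a variable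
-- and the relations `ε*ε≋1` and `1+ε≋0` are applied by hand.
ε : Poly
ε = - 1#

ε*ε≋1 : ε * ε ≋ 1#
ε*ε≋1 = ≋-trans (-1*x≈-x ε) (-‿involutive 1#)

1+ε≋0 : 1# + ε ≋ 0#
1+ε≋0 = -‿inverseʳ 1#

signP≋ : ∀ j f → signP j f ≋ (ε ^P j) * f
signP≋ zero          f = ≋-sym (*-identityˡ f)
signP≋ (suc zero)    f = ≋-sym (≋-trans (*-congʳ {f} (*-identityʳ ε)) (-1*x≈-x f))
signP≋ (suc (suc j)) f = begin≋
  signP j f                        ≈⟨ signP≋ j f ⟩
  (ε ^P j) * f                     ≈⟨ *-identityˡ ((ε ^P j) * f) ⟨
  1# * ((ε ^P j) * f)              ≈⟨ *-congʳ {(ε ^P j) * f} ε*ε≋1 ⟨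
  (ε * ε) * ((ε ^P j) * f)         ≈⟨ psolve 3 (λ e x y → (e ⊗ e) ⊗ (x ⊗ y) ⊜ (e ⊗ (e ⊗ x)) ⊗ y) ≋-refl ε (ε ^P j) f ⟩
  (ε ^P suc (suc j)) * f           ∎≋

signP-cong : ∀ j {f g} → f ≋ g → signP j f ≋ signP j g
signP-cong j {f} {g} e = ≋-trans (signP≋ j f) (≋-trans (*-congˡ {ε ^P j} e) (≋-sym (signP≋ j g)))

-- Determinants: two-row Laplace expansion and alternation

minor : ∀ {n} → (Fin n → Row (suc n)) → Fin (suc n) → Matrix n
minor N j i l = N i (punchIn j l)

det-cong : ∀ n {M N : Matrix n} → (∀ i j → M i j ≋ N i j) → det n M ≋ det n N
det-cong zero    e = ≋-refl
det-cong (suc n) e = sumP-cong (suc n) λ j → signP-cong (toℕ j)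
  (*-cong (e zero j) (det-cong n (λ i l → e (suc i) (punchIn j l))))

det-expand : ∀ n (M : Matrix (suc n)) →
  det (suc n) M ≋ sumP (suc n) (λ j → (ε ^P toℕ j) * (M zero j * det n (minor (M ∘ suc) j)))
det-expand n M = sumP-cong (suc n) λ j → signP≋ (toℕ j) (M zero j * det n (minor (M ∘ suc) j))

-- Laplace expansion along the first two rows a and b: P takes the map choosing
-- the remaining n columns to the complementary minor.
expand₂ : ∀ n (a b : Row (2 ℕ.+ n)) (P : (Fin n → Fin (2 ℕ.+ n)) → Poly) → Poly
expand₂ n a b P = sumP (2 ℕ.+ n) λ j → (ε ^P toℕ j) * (a j *
  sumP (1 ℕ.+ n) λ l → (ε ^P toℕ l) * (b (punchIn j l) * P (punchIn j ∘ punchIn l)))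

det-expand₂ : ∀ n (M : Matrix (2 ℕ.+ n)) →
  det (2 ℕ.+ n) M ≋ expand₂ n (M zero) (M (suc zero)) (λ f → det n (λ i l → M (suc (suc i)) (f l)))
det-expand₂ n M = ≋-trans (det-expand (suc n) M) (sumP-cong (2 ℕ.+ n) λ j →
  *-congˡ {ε ^P toℕ j} (*-congˡ {M zero j} (det-expand n (minor (M ∘ suc) j))))

-- Column selections are functions that often agree only pointwise, so the minors have to respect
-- pointwise equality.
Extensional : ∀ {m n} → ((Fin m → Fin n) → Poly) → Set
Extensional P = ∀ {f g} → f ≗ g → P f ≋ P g

module _ (n : ℕ) (a b : Row (2 ℕ.+ n)) (P : (Fin n → Fin (2 ℕ.+ n)) → Poly) where

  -- The terms in which the other of the two rows takes column 0, without that row's entry; `c`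
  -- takes column `suc l`.
  expand-fixing-0 : Row (2 ℕ.+ n) → Poly
  expand-fixing-0 c = sumP (1 ℕ.+ n) λ l → (ε ^P toℕ l) * (c (suc l) * P (suc ∘ punchIn l))

  expand-avoiding-0 : Poly
  expand-avoiding-0 = sumP (1 ℕ.+ n) λ j → (ε ^P toℕ j) * (a (suc j) *
    sumP n λ l → (ε ^P toℕ l) * (b (suc (punchIn j l)) * P (punchIn (suc j) ∘ punchIn (suc l))))

  -- The terms are sorted by the row that takes column 0. If it is b, the column of a is shifted by
  -- one and contributes one factor `ε`; if it is neither, both columns are shifted and `ε * ε`
  -- cancels.
  expand₂-split : Extensional P → expand₂ n a b P ≋
    a zero * expand-fixing-0 b + (ε * (b zero * expand-fixing-0 a) + expand-avoiding-0)
  expand₂-split ext = +-cong (*-identityˡ (a zero * expand-fixing-0 b)) (begin≋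
    sumP (1 ℕ.+ n) (λ j → (ε * (ε ^P toℕ j)) * (a (suc j) * (1# * (b zero * P (punchIn (suc j) ∘ suc)) + inner′ j)))
      ≈⟨ sumP-cong (1 ℕ.+ n) step ⟩
    sumP (1 ℕ.+ n) (λ j → (ε * b zero) * fixed j + avoiding j)
      ≈⟨ sumP-+ (1 ℕ.+ n) (λ j → (ε * b zero) * fixed j) avoiding ⟩
    sumP (1 ℕ.+ n) (λ j → (ε * b zero) * fixed j) + expand-avoiding-0
      ≈⟨ +-congʳ {expand-avoiding-0} (sumP-* (1 ℕ.+ n) (ε * b zero) fixed) ⟩
    (ε * b zero) * expand-fixing-0 a + expand-avoiding-0
      ≈⟨ +-congʳ {expand-avoiding-0} (*-assoc ε (b zero) (expand-fixing-0 a)) ⟩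
    ε * (b zero * expand-fixing-0 a) + expand-avoiding-0 ∎≋)
    where
    summand : Fin (1 ℕ.+ n) → Fin n → Poly
    summand j l = b (suc (punchIn j l)) * P (punchIn (suc j) ∘ punchIn (suc l))
    inner inner′ fixed avoiding : Fin (1 ℕ.+ n) → Poly
    inner  j = sumP n λ l → (ε ^P toℕ l) * summand j l
    inner′ j = sumP n λ l → (ε * (ε ^P toℕ l)) * summand j l
    fixed  j = (ε ^P toℕ j) * (a (suc j) * P (suc ∘ punchIn j))
    avoiding j = (ε ^P toℕ j) * (a (suc j) * inner j)
    inner′≋ : ∀ j → inner′ j ≋ ε * inner j
    inner′≋ j = ≋-trans (sumP-cong n (λ l → *-assoc ε (ε ^P toℕ l) (summand j l)))
                        (sumP-* n ε (λ l → (ε ^P toℕ l) * summand j l))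
    step : ∀ j → (ε * (ε ^P toℕ j)) * (a (suc j) * (1# * (b zero * P (punchIn (suc j) ∘ suc)) + inner′ j))
               ≋ (ε * b zero) * fixed j + avoiding j
    step j = begin≋
      (ε * (ε ^P toℕ j)) * (a (suc j) * (1# * (b zero * P (punchIn (suc j) ∘ suc)) + inner′ j))
        ≈⟨ *-congˡ {ε * (ε ^P toℕ j)} (*-congˡ {a (suc j)} (+-cong (*-congˡ {1#} (*-congˡ {b zero} (ext (λ _ → refl)))) (inner′≋ j))) ⟩
      (ε * (ε ^P toℕ j)) * (a (suc j) * (1# * (b zero * P (suc ∘ punchIn j)) + ε * inner j))
        ≈⟨ psolve 6 (λ e x y z p s → (e ⊗ x) ⊗ (y ⊗ (con 1 ⊗ (z ⊗ p) ⊕ e ⊗ s))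
                       ⊜ (e ⊗ z) ⊗ (x ⊗ (y ⊗ p)) ⊕ (e ⊗ e) ⊗ (x ⊗ (y ⊗ s))) ≋-refl
             ε (ε ^P toℕ j) (a (suc j)) (b zero) (P (suc ∘ punchIn j)) (inner j) ⟩
      (ε * b zero) * fixed j + (ε * ε) * avoiding j
        ≈⟨ +-congˡ {(ε * b zero) * fixed j} (≋-trans (*-congʳ {avoiding j} ε*ε≋1) (*-identityˡ (avoiding j))) ⟩
      (ε * b zero) * fixed j + avoiding j ∎≋

antisymmetric-cancel : ∀ x y → (x + ε * y) + (y + ε * x) ≋ 0#
antisymmetric-cancel x y = begin≋
  (x + ε * y) + (y + ε * x)  ≈⟨ psolve 3 (λ x y e → (x ⊕ e ⊗ y) ⊕ (y ⊕ e ⊗ x) ⊜ (con 1 ⊕ e) ⊗ (x ⊕ y)) ≋-refl x y ε ⟩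
  (1# + ε) * (x + y)         ≈⟨ *-congʳ {x + y} 1+ε≋0 ⟩
  0# * (x + y)               ≈⟨ zeroˡ (x + y) ⟩
  0#                         ∎≋

-- Mutual induction with the next lemma. Exchanging a and b exchanges the terms where a takes column
-- 0 with those where b does, and these differ by a factor `ε`; the remaining terms form the same
-- kind of expansion with column 0 left out.
expand₂-antisym : ∀ n (a b : Row (2 ℕ.+ n)) (P : (Fin n → Fin (2 ℕ.+ n)) → Poly) → Extensional P →
  expand₂ n a b P + expand₂ n b a P ≋ 0#
expand-avoiding-0-antisym : ∀ n (a b : Row (2 ℕ.+ n)) (P : (Fin n → Fin (2 ℕ.+ n)) → Poly) → Extensional P →
  expand-avoiding-0 n a b P + expand-avoiding-0 n b a P ≋ 0#

expand₂-antisym n a b P ext = begin≋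
  expand₂ n a b P + expand₂ n b a P
    ≈⟨ +-cong (expand₂-split n a b P ext) (expand₂-split n b a P ext) ⟩
  (x + (ε * y + s)) + (y + (ε * x + t))
    ≈⟨ psolve 5 (λ x y s t e → (x ⊕ (e ⊗ y ⊕ s)) ⊕ (y ⊕ (e ⊗ x ⊕ t)) ⊜ ((x ⊕ e ⊗ y) ⊕ (y ⊕ e ⊗ x)) ⊕ (s ⊕ t)) ≋-refl x y s t ε ⟩
  ((x + ε * y) + (y + ε * x)) + (s + t)
    ≈⟨ +-cong (antisymmetric-cancel x y) (expand-avoiding-0-antisym n a b P ext) ⟩
  0# + 0#
    ≈⟨ +-identityˡ 0# ⟩
  0# ∎≋
  where
  x = a zero * expand-fixing-0 n a b P b
  y = b zero * expand-fixing-0 n a b P a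
  s = expand-avoiding-0 n a b P
  t = expand-avoiding-0 n b a P

-- Two rows cannot both avoid column 0 when there are only two columns: the inner sum is empty.
expand-avoiding-0-antisym zero a b P ext = ≋-trans (+-cong (vanishes a) (vanishes b)) (+-identityˡ 0#)
  where
  vanishes : ∀ (c : Row 2) → 1# * (c (suc zero) * 0#) + 0# ≋ 0#
  vanishes c = psolve 1 (λ x → con 1 ⊗ (x ⊗ con 0) ⊕ con 0 ⊜ con 0) ≋-refl (c (suc zero))
-- Column 0 always survives into the minor, so `lift 1` adds it to a selection among the other
-- columns.
expand-avoiding-0-antisym (suc n) a b P ext = ≋-trans (+-cong (lifted a b) (lifted b a))
  (expand₂-antisym n (a ∘ suc) (b ∘ suc) (P ∘ lift 1) (λ e → ext (lift-cong e)))
  where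
  lift-cong : ∀ {m n} {f g : Fin m → Fin n} → f ≗ g → lift 1 f ≗ lift 1 g
  lift-cong e zero    = refl
  lift-cong e (suc i) = cong suc (e i)
  punchIn-lift : ∀ j l → punchIn (suc j) ∘ punchIn (suc l) ≗ lift 1 (punchIn j ∘ punchIn l)
  punchIn-lift j l zero    = refl
  punchIn-lift j l (suc i) = refl
  lifted : ∀ a b → expand-avoiding-0 (suc n) a b P ≋ expand₂ n (a ∘ suc) (b ∘ suc) (P ∘ lift 1)
  lifted a b = sumP-cong (2 ℕ.+ n) λ j → *-congˡ {ε ^P toℕ j} (*-congˡ {a (suc j)}
    (sumP-cong (1 ℕ.+ n) λ l → *-congˡ {ε ^P toℕ l} (*-congˡ {b (suc (punchIn j l))} (ext (punchIn-lift j l)))))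

swap₀₁ : ∀ {n} → Fin (2 ℕ.+ n) → Fin (2 ℕ.+ n)
swap₀₁ zero          = suc zero
swap₀₁ (suc zero)    = zero
swap₀₁ (suc (suc i)) = suc (suc i)

det-swap₀₁ : ∀ n (M : Matrix (2 ℕ.+ n)) → det (2 ℕ.+ n) M + det (2 ℕ.+ n) (M ∘ swap₀₁) ≋ 0#
det-swap₀₁ n M = ≋-trans
  (+-cong (det-expand₂ n M) (det-expand₂ n (M ∘ swap₀₁)))
  (expand₂-antisym n (M zero) (M (suc zero)) (λ f → det n (λ i l → M (suc (suc i)) (f l)))
    (λ e → det-cong n (λ i l → reflexive (cong (M (suc (suc i))) (e l)))))

-- Induction on the position of the repeated row. If the equal rows are adjacent, swapping them
-- changes nothing, so twice the determinant is 0. Otherwise the first row is swapped down by one,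
-- and in the expansion along the new first row every minor starts with a row that is repeated one
-- place nearer.
det-repeated-row : ∀ n (M : Matrix (suc n)) i → (∀ j → M zero j ≋ M (suc i) j) → det (suc n) M ≋ 0#
det-repeated-row (suc n) M zero e = x+x≋0⇒x≋0 (≋-trans
  (+-congˡ {det (2 ℕ.+ n) M} (det-cong (2 ℕ.+ n) {M} {M ∘ swap₀₁} unchanged)) (det-swap₀₁ n M))
  where
  unchanged : ∀ i j → M i j ≋ M (swap₀₁ i) j
  unchanged zero          j = e j
  unchanged (suc zero)    j = ≋-sym (e j)
  unchanged (suc (suc i)) j = ≋-refl
det-repeated-row (suc n) M (suc i) e = begin≋
  det (2 ℕ.+ n) M                                      ≈⟨ +-identityʳ (det (2 ℕ.+ n) M) ⟨
  det (2 ℕ.+ n) M + 0#                                 ≈⟨ +-congˡ {det (2 ℕ.+ n) M} swapped≋0 ⟨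
  det (2 ℕ.+ n) M + det (2 ℕ.+ n) (M ∘ swap₀₁)         ≈⟨ det-swap₀₁ n M ⟩
  0#                                                   ∎≋
  where
  swapped≋0 : det (2 ℕ.+ n) (M ∘ swap₀₁) ≋ 0#
  swapped≋0 = ≋-trans (det-expand (suc n) (M ∘ swap₀₁)) (sumP-0 (2 ℕ.+ n) λ j → begin≋
    (ε ^P toℕ j) * (M (suc zero) j * det (suc n) (minor (M ∘ swap₀₁ ∘ suc) j))
      ≈⟨ *-congˡ {ε ^P toℕ j} (*-congˡ {M (suc zero) j}
           (det-repeated-row n (minor (M ∘ swap₀₁ ∘ suc) j) i (λ l → e (punchIn j l)))) ⟩
    (ε ^P toℕ j) * (M (suc zero) j * 0#)
      ≈⟨ psolve 2 (λ x y → x ⊗ (y ⊗ con 0) ⊜ con 0) ≋-refl (ε ^P toℕ j) (M (suc zero) j) ⟩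
    0# ∎≋)

-- Linearity in the first row and spans of rows

module _ {n} (N : Fin n → Row (suc n)) where

  private
    cofactor : Fin (suc n) → Poly
    cofactor j = det n (minor N j)

  det-row₀-+ : ∀ u v → det (suc n) ((λ j → u j + v j) ∷ N) ≋ det (suc n) (u ∷ N) + det (suc n) (v ∷ N)
  det-row₀-+ u v = begin≋
    det (suc n) ((λ j → u j + v j) ∷ N)
      ≈⟨ det-expand n ((λ j → u j + v j) ∷ N) ⟩
    sumP (suc n) (λ j → (ε ^P toℕ j) * ((u j + v j) * cofactor j))
      ≈⟨ sumP-cong (suc n) (λ j → psolve 4 (λ e x y z → e ⊗ ((x ⊕ y) ⊗ z) ⊜ e ⊗ (x ⊗ z) ⊕ e ⊗ (y ⊗ z)) ≋-refl
           (ε ^P toℕ j) (u j) (v j) (cofactor j)) ⟩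
    sumP (suc n) (λ j → (ε ^P toℕ j) * (u j * cofactor j) + (ε ^P toℕ j) * (v j * cofactor j))
      ≈⟨ sumP-+ (suc n) (λ j → (ε ^P toℕ j) * (u j * cofactor j)) (λ j → (ε ^P toℕ j) * (v j * cofactor j)) ⟩
    sumP (suc n) (λ j → (ε ^P toℕ j) * (u j * cofactor j)) + sumP (suc n) (λ j → (ε ^P toℕ j) * (v j * cofactor j))
      ≈⟨ +-cong (det-expand n (u ∷ N)) (det-expand n (v ∷ N)) ⟨
    det (suc n) (u ∷ N) + det (suc n) (v ∷ N) ∎≋

  det-row₀-* : ∀ a v → det (suc n) ((λ j → a * v j) ∷ N) ≋ a * det (suc n) (v ∷ N)
  det-row₀-* a v = begin≋
    det (suc n) ((λ j → a * v j) ∷ N)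
      ≈⟨ det-expand n ((λ j → a * v j) ∷ N) ⟩
    sumP (suc n) (λ j → (ε ^P toℕ j) * ((a * v j) * cofactor j))
      ≈⟨ sumP-cong (suc n) (λ j → psolve 4 (λ e a y z → e ⊗ ((a ⊗ y) ⊗ z) ⊜ a ⊗ (e ⊗ (y ⊗ z))) ≋-refl
           (ε ^P toℕ j) a (v j) (cofactor j)) ⟩
    sumP (suc n) (λ j → a * ((ε ^P toℕ j) * (v j * cofactor j)))
      ≈⟨ sumP-* (suc n) a (λ j → (ε ^P toℕ j) * (v j * cofactor j)) ⟩
    a * sumP (suc n) (λ j → (ε ^P toℕ j) * (v j * cofactor j))
      ≈⟨ *-congˡ {a} (det-expand n (v ∷ N)) ⟨
    a * det (suc n) (v ∷ N) ∎≋

  det-row₀-cong : ∀ {u v} → (∀ j → u j ≋ v j) → det (suc n) (u ∷ N) ≋ det (suc n) (v ∷ N)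
  det-row₀-cong {u} {v} e = det-cong (suc n) {u ∷ N} {v ∷ N} λ { zero j → e j ; (suc i) j → ≋-refl }

  det-row₀-0 : det (suc n) ((λ _ → 0#) ∷ N) ≋ 0#
  det-row₀-0 = begin≋
    det (suc n) ((λ _ → 0#) ∷ N)      ≈⟨ det-row₀-cong (λ _ → ≋-sym (zeroˡ 0#)) ⟩
    det (suc n) ((λ _ → 0# * 0#) ∷ N) ≈⟨ det-row₀-* 0# (λ _ → 0#) ⟩
    0# * det (suc n) ((λ _ → 0#) ∷ N) ≈⟨ zeroˡ (det (suc n) ((λ _ → 0#) ∷ N)) ⟩
    0#                                ∎≋

-- Rows are infinite sequences here, so that they can be shifted by a column and restricted to any
-- matrix size. Inductive membership lets linearity of the determinant be used constructor by
-- constructor.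
data Span (v : ℕ → ℕ → Poly) (m : ℕ) : (ℕ → Poly) → Set where
  generator : ∀ {i} → i < m → Span v m (v i)
  null      : Span v m (λ _ → 0#)
  plus      : ∀ {u w} → Span v m u → Span v m w → Span v m (λ j → u j + w j)
  scale     : ∀ a {w} → Span v m w → Span v m (λ j → a * w j)
  respects      : ∀ {u w} → (∀ j → u j ≋ w j) → Span v m u → Span v m w

Span-suc : ∀ {v m w} → Span v m w → Span v (suc m) w
Span-suc (generator i<m) = generator (ℕₚ.m<n⇒m<1+n i<m)
Span-suc null            = null
Span-suc (plus s t)      = plus (Span-suc s) (Span-suc t)
Span-suc (scale a s)     = scale a (Span-suc s)
Span-suc (respects e s)      = respects e (Span-suc s)

shifts : (ℕ → Poly) → ℕ → ℕ → Poly
shifts μ i j = μ (i ℕ.+ j)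

-- The Hankel property: dropping the first column of row i gives row i + 1.
Span-shift : ∀ μ {m w} → Span (shifts μ) m w → Span (shifts μ) (suc m) (w ∘ suc)
Span-shift μ (generator {i} i<m) =
  respects (λ j → reflexive (cong μ (sym (ℕₚ.+-suc i j)))) (generator (s≤s i<m))
Span-shift μ null           = null
Span-shift μ (plus s t)     = plus (Span-shift μ s) (Span-shift μ t)
Span-shift μ (scale a s)    = scale a (Span-shift μ s)
Span-shift μ (respects e s) = respects (e ∘ suc) (Span-shift μ s)

module _ {n} (N : Fin n → Row (suc n)) (v : ℕ → ℕ → Poly) where

  -- Linearity reduces the claim to a generator, which by hypothesis repeats one of the rows of `N`.
  det-row₀-Span : (∀ {i} → i < n → ∃[ r ] (∀ j → v i (toℕ j) ≋ N r j)) →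
    ∀ {w} → Span v n w → det (suc n) ((w ∘ toℕ) ∷ N) ≋ 0#
  det-row₀-Span rows (generator {i} i<n) with rows i<n
  ... | r , e = det-repeated-row n ((v i ∘ toℕ) ∷ N) r e
  det-row₀-Span rows null = det-row₀-0 N
  det-row₀-Span rows (plus {u} {w} s t) = ≋-trans (det-row₀-+ N (u ∘ toℕ) (w ∘ toℕ))
    (≋-trans (+-cong (det-row₀-Span rows s) (det-row₀-Span rows t)) (+-identityˡ 0#))
  det-row₀-Span rows (scale a {w} s) = ≋-trans (det-row₀-* N a (w ∘ toℕ))
    (≋-trans (*-congˡ {a} (det-row₀-Span rows s)) (zeroʳ a))
  det-row₀-Span rows (respects {u} {w} e s) = ≋-trans
    (det-row₀-cong N {w ∘ toℕ} {u ∘ toℕ} (λ j → ≋-sym (e (toℕ j)))) (det-row₀-Span rows s)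

-- Reducing a Hankel determinant with reversed rows

-- The index n - 1 - i, defined by recursion so that deleting the first row of a larger `toeplitz`
-- matrix leaves the rows of the smaller one by computation.
rev : ∀ {n} → Fin n → ℕ
rev {suc n} zero    = n
rev {suc n} (suc i) = rev i

rev-surjective : ∀ {n i} → i < n → ∃[ r ] rev {n} r ≡ i
rev-surjective {suc n} {i} i<1+n with ℕₚ.m<1+n⇒m<n∨m≡n i<1+n
... | inj₂ refl = zero , refl
... | inj₁ i<n with rev-surjective i<n
...   | r , e = suc r , e

-- The Hankel matrix of μ with its rows in reverse order, i.e. a Toeplitz matrix.
toeplitz : (ℕ → Poly) → ∀ n → Matrix n
toeplitz μ n i j = shifts μ (rev i) (toℕ j)

-- Adding w, a combination of the lower rows, to the first row keeps the determinant and leaves p in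
-- the last column as its only possibly nonzero entry. The sign there is (-1)^n, and deleting the
-- first row and last column gives the matrix of size n.
det-toeplitz-reduce : ∀ μ n {w p} →
  Span (shifts μ) n w →
  (∀ {j} → j < n → μ (n ℕ.+ j) + w j ≋ 0#) → μ (n ℕ.+ n) + w n ≋ p →
  det (suc n) (toeplitz μ (suc n)) ≋ (ε ^P n) * (p * det n (toeplitz μ n))
det-toeplitz-reduce μ n {w} {p} s below diagonal = begin≋
  det (suc n) (toeplitz μ (suc n))
    ≈⟨ +-identityʳ (det (suc n) (toeplitz μ (suc n))) ⟨
  det (suc n) (toeplitz μ (suc n)) + 0#
    ≈⟨ +-cong (det-cong (suc n) {toeplitz μ (suc n)} {(shifts μ n ∘ toℕ) ∷ N} λ { zero j → ≋-refl ; (suc i) j → ≋-refl }) (≋-sym (det-row₀-Span N (shifts μ) rows s)) ⟩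
  det (suc n) ((shifts μ n ∘ toℕ) ∷ N) + det (suc n) ((w ∘ toℕ) ∷ N)
    ≈⟨ det-row₀-+ N (shifts μ n ∘ toℕ) (w ∘ toℕ) ⟨
  det (suc n) (u ∷ N)
    ≈⟨ det-expand n (u ∷ N) ⟩
  sumP (suc n) (λ j → (ε ^P toℕ j) * (u j * det n (minor N j)))
    ≈⟨ sumP-last n {λ j → (ε ^P toℕ j) * (u j * det n (minor N j))} (λ j →
         ≋-trans (*-congˡ {ε ^P toℕ (inject₁ j)} (≋-trans (*-congʳ {det n (minor N (inject₁ j))} (below (inject₁<n j)))
                                                            (zeroˡ (det n (minor N (inject₁ j))))))
                 (zeroʳ (ε ^P toℕ (inject₁ j)))) ⟩
  (ε ^P toℕ (fromℕ n)) * (u (fromℕ n) * det n (minor N (fromℕ n)))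
    ≈⟨ *-cong (reflexive (cong (ε ^P_) (Finₚ.toℕ-fromℕ n)))
              (*-cong u-last (det-cong n (λ i l → reflexive (cong (shifts μ (rev i)) (punchIn-last l))))) ⟩
  (ε ^P n) * (p * det n (toeplitz μ n)) ∎≋
  where
  N : Fin n → Row (suc n)
  N i j = shifts μ (rev i) (toℕ j)
  u : Row (suc n)
  u j = shifts μ n (toℕ j) + w (toℕ j)
  rows : ∀ {i} → i < n → ∃[ r ] (∀ j → shifts μ i (toℕ j) ≋ N r j)
  rows i<n with rev-surjective i<n
  ... | r , refl = r , λ _ → ≋-refl
  inject₁<n : ∀ j → toℕ (inject₁ {n} j) < n
  inject₁<n j = subst (_< n) (sym (Finₚ.toℕ-inject₁ j)) (Finₚ.toℕ<n j)
  u-last : u (fromℕ n) ≋ p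
  u-last = ≋-trans (reflexive (cong (λ j → shifts μ n j + w j) (Finₚ.toℕ-fromℕ n))) diagonal
  punchIn-last : ∀ {n} (l : Fin n) → toℕ (punchIn (fromℕ n) l) ≡ toℕ l
  punchIn-last zero    = refl
  punchIn-last (suc l) = cong suc (punchIn-last l)

-- Powers, and Hankel determinants from a three-term recurrence

^P-+ : ∀ f m n → (f ^P (m ℕ.+ n)) ≋ (f ^P m) * (f ^P n)
^P-+ f zero    n = ≋-sym (*-identityˡ (f ^P n))
^P-+ f (suc m) n = ≋-trans (*-congˡ {f} (^P-+ f m n)) (≋-sym (*-assoc f (f ^P m) (f ^P n)))

^P-* : ∀ f g n → (f ^P n) * (g ^P n) ≋ (f * g) ^P n
^P-* f g zero    = *-identityˡ 1P
^P-* f g (suc n) = begin≋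
  (f * (f ^P n)) * (g * (g ^P n))  ≈⟨ psolve 4 (λ a b c d → (a ⊗ b) ⊗ (c ⊗ d) ⊜ (a ⊗ c) ⊗ (b ⊗ d)) ≋-refl f (f ^P n) g (g ^P n) ⟩
  (f * g) * ((f ^P n) * (g ^P n))  ≈⟨ *-congˡ {f * g} (^P-* f g n) ⟩
  (f * g) ^P suc n                 ∎≋

^P-cong : ∀ {f g} n → f ≋ g → (f ^P n) ≋ (g ^P n)
^P-cong zero    e = ≋-refl
^P-cong (suc n) e = *-cong e (^P-cong n e)

-- W (suc m) is row m of the Hankel matrix of μ reduced modulo the rows 0, …, m − 1.
module _ (μ : ℕ → Poly) (W : ℕ → ℕ → Poly) (b : ℕ → Poly) (c : Poly)
  (W0 : ∀ j → W 0 j ≋ 0#) (W1 : ∀ j → W 1 j ≋ μ j)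
  (W-rec : ∀ m j → W (1 ℕ.+ m) (1 ℕ.+ j) ≋ W (2 ℕ.+ m) j + (b m * W (1 ℕ.+ m) j + c * W m j))
  (W-below : ∀ {m j} → j < m → W (suc m) j ≋ 0#)
  (W-diag : ∀ m → W (suc m) m ≋ qP ^P m) where

  private
    Reduces : ℕ → Set
    Reduces m = ∃[ w ] Span (shifts μ) m w × (∀ j → shifts μ m j + w j ≋ W (suc m) j)

    previous-in-Span : ∀ m → Reduces m → Span (shifts μ) (suc m) (W (suc m))
    previous-in-Span m (w , s , e) = respects e (plus (generator ℕₚ.≤-refl) (Span-suc s))

    -- Shifting the reduction of row m by one column gives a reduction of row m + 1 to
    -- `W (1 + m) (1 + j)`. By `W-rec` it remains to subtract multiples of `W (1 + m)` and `W m`;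
    -- the second component is carried along because it places `W m` in the span of the earlier
    -- rows.
    reduces : ∀ m → Reduces m × Span (shifts μ) m (W m)
    reduces zero    = ((λ _ → 0#) , null , λ j → ≋-trans (+-identityʳ (μ j)) (≋-sym (W1 j)))
                    , respects (λ j → ≋-sym (W0 j)) null
    reduces (suc m) with reduces m
    ... | r@(w , s , e) , t =
      ( (λ j → w (suc j) + ε * (b m * W (suc m) j + c * W m j))
      , plus (Span-shift μ s) (scale ε (plus (scale (b m) (previous-in-Span m r)) (scale c (Span-suc t))))
      , λ j → let y = b m * W (suc m) j + c * W m j in begin≋
          μ (suc m ℕ.+ j) + (w (suc j) + ε * y)
            ≈⟨ +-congʳ {w (suc j) + ε * y} (reflexive (cong μ (ℕₚ.+-suc m j))) ⟨
          μ (m ℕ.+ suc j) + (w (suc j) + ε * y)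
            ≈⟨ psolve 4 (λ a b e y → a ⊕ (b ⊕ e ⊗ y) ⊜ (a ⊕ b) ⊕ e ⊗ y) ≋-refl (μ (m ℕ.+ suc j)) (w (suc j)) ε y ⟩
          (μ (m ℕ.+ suc j) + w (suc j)) + ε * y
            ≈⟨ +-congʳ {ε * y} (≋-trans (e (suc j)) (W-rec m j)) ⟩
          (W (2 ℕ.+ m) j + y) + ε * y
            ≈⟨ psolve 3 (λ a y e → (a ⊕ y) ⊕ e ⊗ y ⊜ a ⊕ (con 1 ⊕ e) ⊗ y) ≋-refl (W (2 ℕ.+ m) j) y ε ⟩
          W (2 ℕ.+ m) j + (1# + ε) * y
            ≈⟨ +-congˡ {W (2 ℕ.+ m) j} (≋-trans (*-congʳ {y} 1+ε≋0) (zeroˡ y)) ⟩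
          W (2 ℕ.+ m) j + 0#
            ≈⟨ +-identityʳ (W (2 ℕ.+ m) j) ⟩
          W (2 ℕ.+ m) j ∎≋ )
      , previous-in-Span m r

  det-toeplitz-suc : ∀ n → det (suc n) (toeplitz μ (suc n)) ≋ ((- qP) ^P n) * det n (toeplitz μ n)
  det-toeplitz-suc n with reduces n
  ... | (w , s , e) , _ = begin≋
    det (suc n) (toeplitz μ (suc n))
      ≈⟨ det-toeplitz-reduce μ n s (λ {j} j<n → ≋-trans (e j) (W-below j<n)) (≋-trans (e n) (W-diag n)) ⟩
    (ε ^P n) * ((qP ^P n) * det n (toeplitz μ n))
      ≈⟨ *-assoc (ε ^P n) (qP ^P n) (det n (toeplitz μ n)) ⟨
    ((ε ^P n) * (qP ^P n)) * det n (toeplitz μ n)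
      ≈⟨ *-congʳ {det n (toeplitz μ n)} (≋-trans (^P-* ε qP n) (^P-cong n (-1*x≈-x qP))) ⟩
    ((- qP) ^P n) * det n (toeplitz μ n) ∎≋

  det-toeplitz : ∀ n → det n (toeplitz μ n) ≋ (- qP) ^P (n C 2)
  det-toeplitz zero    = ≋-refl
  det-toeplitz (suc n) = begin≋
    det (suc n) (toeplitz μ (suc n))           ≈⟨ det-toeplitz-suc n ⟩
    ((- qP) ^P n) * det n (toeplitz μ n)       ≈⟨ *-congˡ {(- qP) ^P n} (det-toeplitz n) ⟩
    ((- qP) ^P n) * ((- qP) ^P (n C 2))        ≈⟨ ^P-+ (- qP) n (n C 2) ⟨
    (- qP) ^P (n ℕ.+ n C 2)                    ≈⟨ reflexive (cong ((- qP) ^P_) binomial) ⟩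
    (- qP) ^P (suc n C 2)                      ∎≋
    where
    binomial : n ℕ.+ n C 2 ≡ suc n C 2
    binomial = trans (cong (ℕ._+ n C 2) (sym (nC1≡n n))) (nCk+nC[k+1]≡[n+1]C[k+1] n 1)

-- Binomial identities and the reflection formula

-- The ratio (d + 1) C(n, d + 1) = (n - d) C(n, d), kept free of subtraction; induction on n by
-- Pascal's rule.
absorption : ∀ n d → suc d ℕ.* (n C suc d) ℕ.+ d ℕ.* (n C d) ≡ n ℕ.* (n C d)
absorption zero    zero    = refl
absorption zero    (suc d) = cong₂ ℕ._+_ (ℕₚ.*-zeroʳ (suc d)) (ℕₚ.*-zeroʳ d)
absorption (suc n) zero    = begin
  1 ℕ.* (suc n C 1) ℕ.+ 0      ≡⟨ cong (λ x → 1 ℕ.* x ℕ.+ 0) (nC1≡n (suc n)) ⟩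
  1 ℕ.* suc n ℕ.+ 0            ≡⟨ identity (suc n) ⟩
  suc n ℕ.* 1                  ∎
  where
  identity : ∀ n → 1 ℕ.* n ℕ.+ 0 ≡ n ℕ.* 1
  identity = ℕ-RingSolver.solve-∀
absorption (suc n) (suc d) = begin
  (2 ℕ.+ d) ℕ.* (suc n C (2 ℕ.+ d)) ℕ.+ suc d ℕ.* (suc n C suc d)
    ≡⟨ cong₂ (λ s t → (2 ℕ.+ d) ℕ.* s ℕ.+ suc d ℕ.* t) (nCk+nC[k+1]≡[n+1]C[k+1] n (suc d)) (nCk+nC[k+1]≡[n+1]C[k+1] n d) ⟨
  (2 ℕ.+ d) ℕ.* (y ℕ.+ z) ℕ.+ suc d ℕ.* (x ℕ.+ y)
    ≡⟨ split d x y z ⟩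
  ((2 ℕ.+ d) ℕ.* z ℕ.+ suc d ℕ.* y) ℕ.+ (suc d ℕ.* y ℕ.+ d ℕ.* x) ℕ.+ (x ℕ.+ y)
    ≡⟨ cong₂ (λ s t → s ℕ.+ t ℕ.+ (x ℕ.+ y)) (absorption n (suc d)) (absorption n d) ⟩
  n ℕ.* y ℕ.+ n ℕ.* x ℕ.+ (x ℕ.+ y)
    ≡⟨ collect n x y ⟩
  suc n ℕ.* (x ℕ.+ y)
    ≡⟨ cong (suc n ℕ.*_) (nCk+nC[k+1]≡[n+1]C[k+1] n d) ⟩
  suc n ℕ.* (suc n C suc d) ∎
  where
  x = n C d
  y = n C suc d
  z = n C (2 ℕ.+ d)
  split : ∀ d x y z → (2 ℕ.+ d) ℕ.* (y ℕ.+ z) ℕ.+ suc d ℕ.* (x ℕ.+ y)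
    ≡ ((2 ℕ.+ d) ℕ.* z ℕ.+ suc d ℕ.* y) ℕ.+ (suc d ℕ.* y ℕ.+ d ℕ.* x) ℕ.+ (x ℕ.+ y)
  split = ℕ-RingSolver.solve-∀
  collect : ∀ n x y → n ℕ.* y ℕ.+ n ℕ.* x ℕ.+ (x ℕ.+ y) ≡ suc n ℕ.* (x ℕ.+ y)
  collect = ℕ-RingSolver.solve-∀

-- binomial n (2 + d) = n C d: the shift makes room for the indices −1 and −2.
binomial : ℕ → ℕ → ℕ
binomial n (suc (suc d)) = n C d
binomial n _             = 0

-- The padding extends the rule over the left edge of the triangle: at i = 1 it reads 1 = 0 + 1.
pascal : ∀ n i → binomial (suc n) (suc i) ≡ binomial n i ℕ.+ binomial n (suc i)
pascal n zero          = refl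
pascal n (suc zero)    = refl
pascal n (suc (suc d)) = sym (nCk+nC[k+1]≡[n+1]C[k+1] n d)

-- Both arguments k and i are shifted by one, so that the boundary values are 0: ballot n k i is the
-- coefficient of q^(i − 1) in the number of Motzkin paths of n steps from height 0 to height k − 1
-- with down steps of weight q and level steps of weight 1 + q.
ballot : ℕ → ℕ → ℕ → ℕ
ballot n       zero    i       = 0
ballot n       (suc k) zero    = 0
ballot zero    1       1       = 1
ballot zero    (suc k) (suc i) = 0
ballot (suc n) (suc k) (suc i) =
  ballot n k (suc i) ℕ.+ (ballot n (suc k) (suc i) ℕ.+ (ballot n (suc k) i ℕ.+ ballot n (2 ℕ.+ k) i))

-- The reflection principle: both products obey the recurrence of ballot by Pascal's rule.
ballot-reflection : ∀ n k i →
  ballot n k i ℕ.+ binomial n i ℕ.* binomial n (suc (i ℕ.+ k)) ≡ binomial n (suc i) ℕ.* binomial n (i ℕ.+ k)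
-- Index k = 0 stands for height -1, where the two products differ only in the order of their
-- factors.
ballot-reflection n zero i
  rewrite ℕₚ.+-identityʳ i = ℕₚ.*-comm (binomial n i) (binomial n (suc i))
ballot-reflection n (suc k) zero = refl
ballot-reflection zero (suc zero) (suc zero) = refl
ballot-reflection zero (suc zero) (suc (suc i)) = ℕₚ.*-zeroʳ (binomial 0 (2 ℕ.+ i))
ballot-reflection zero (suc (suc k)) (suc zero) = refl
ballot-reflection zero (suc (suc k)) (suc (suc i)) = ℕₚ.*-zeroʳ (binomial 0 (2 ℕ.+ i))
ballot-reflection (suc n) (suc k) (suc i) = begin
  (s ℕ.+ (t ℕ.+ (u ℕ.+ v))) ℕ.+ binomial (suc n) (suc i) ℕ.* binomial (suc n) (suc (suc i ℕ.+ suc k))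
    ≡⟨ cong₂ (λ x y → (s ℕ.+ (t ℕ.+ (u ℕ.+ v))) ℕ.+ x ℕ.* y) (pascal n i) (pascal n (suc i ℕ.+ suc k)) ⟩
  (s ℕ.+ (t ℕ.+ (u ℕ.+ v))) ℕ.+ (b i ℕ.+ b (suc i)) ℕ.* (b (suc i ℕ.+ suc k) ℕ.+ b (suc (suc i ℕ.+ suc k)))
    -- Each of the four cross terms is paired with one kind of last step: up, level of weight 1,
    -- level of weight q, down.
    ≡⟨ expand s t u v (b i) (b (suc i)) (b (suc i ℕ.+ suc k)) (b (suc (suc i ℕ.+ suc k))) ⟩
  (s ℕ.+ b (suc i) ℕ.* b (suc i ℕ.+ suc k)) ℕ.+ (t ℕ.+ b (suc i) ℕ.* b (suc (suc i ℕ.+ suc k)))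
    ℕ.+ ((u ℕ.+ b i ℕ.* b (suc i ℕ.+ suc k)) ℕ.+ (v ℕ.+ b i ℕ.* b (suc (suc i ℕ.+ suc k))))
    ≡⟨ cong₂ ℕ._+_ (cong₂ ℕ._+_ s-reflection (ballot-reflection n (suc k) (suc i)))
                   (cong₂ ℕ._+_ (ballot-reflection n (suc k) i) v-reflection) ⟩
  b (2 ℕ.+ i) ℕ.* b (i ℕ.+ suc k) ℕ.+ b (2 ℕ.+ i) ℕ.* b (suc i ℕ.+ suc k)
    ℕ.+ (b (suc i) ℕ.* b (i ℕ.+ suc k) ℕ.+ b (suc i) ℕ.* b (suc i ℕ.+ suc k))
    ≡⟨ factor (b (suc i)) (b (2 ℕ.+ i)) (b (i ℕ.+ suc k)) (b (suc i ℕ.+ suc k)) ⟩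
  (b (suc i) ℕ.+ b (2 ℕ.+ i)) ℕ.* (b (i ℕ.+ suc k) ℕ.+ b (suc i ℕ.+ suc k))
    ≡⟨ cong₂ ℕ._*_ (pascal n (suc i)) (pascal n (i ℕ.+ suc k)) ⟨
  binomial (suc n) (2 ℕ.+ i) ℕ.* binomial (suc n) (suc i ℕ.+ suc k) ∎
  where
  b = binomial n
  s = ballot n k (suc i)
  t = ballot n (suc k) (suc i)
  u = ballot n (suc k) i
  v = ballot n (2 ℕ.+ k) i
  s-reflection : s ℕ.+ b (suc i) ℕ.* b (suc i ℕ.+ suc k) ≡ b (2 ℕ.+ i) ℕ.* b (i ℕ.+ suc k)
  s-reflection = subst (λ x → s ℕ.+ b (suc i) ℕ.* b (suc x) ≡ b (2 ℕ.+ i) ℕ.* b x)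
                       (sym (ℕₚ.+-suc i k)) (ballot-reflection n k (suc i))
  v-reflection : v ℕ.+ b i ℕ.* b (suc (suc i ℕ.+ suc k)) ≡ b (suc i) ℕ.* b (suc i ℕ.+ suc k)
  v-reflection = subst (λ x → v ℕ.+ b i ℕ.* b (suc x) ≡ b (suc i) ℕ.* b x)
                       (ℕₚ.+-suc i (suc k)) (ballot-reflection n (2 ℕ.+ k) i)
  expand : ∀ s t u v w x y z → (s ℕ.+ (t ℕ.+ (u ℕ.+ v))) ℕ.+ (w ℕ.+ x) ℕ.* (y ℕ.+ z)
    ≡ (s ℕ.+ x ℕ.* y) ℕ.+ (t ℕ.+ x ℕ.* z) ℕ.+ ((u ℕ.+ w ℕ.* y) ℕ.+ (v ℕ.+ w ℕ.* z))
  expand = ℕ-RingSolver.solve-∀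
  factor : ∀ w x y z → x ℕ.* y ℕ.+ x ℕ.* z ℕ.+ (w ℕ.* y ℕ.+ w ℕ.* z) ≡ (w ℕ.+ x) ℕ.* (y ℕ.+ z)
  factor = ℕ-RingSolver.solve-∀

ballot-below : ∀ {j m} → j < m → ∀ i → ballot j (suc m) i ≡ 0
ballot-below {zero}  {suc m} _ zero    = refl
ballot-below {zero}  {suc m} _ (suc i) = refl
ballot-below {suc j} {suc m} _ zero    = refl
ballot-below {suc j} {suc m} (s≤s j<m) (suc i)
  rewrite ballot-below j<m (suc i) | ballot-below (ℕₚ.m<n⇒m<1+n j<m) (suc i)
        | ballot-below (ℕₚ.m<n⇒m<1+n j<m) i | ballot-below (ℕₚ.m<n⇒m<1+n (ℕₚ.m<n⇒m<1+n j<m)) i = refl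

-- Only up steps lead to height m in m steps, so three of the four summands vanish by
-- `ballot-below`.
ballot-diagonal : ∀ m i → ballot m (suc m) (suc i) ≡ ballot 0 1 (suc i)
ballot-diagonal zero    i = refl
ballot-diagonal (suc m) i
  rewrite ballot-diagonal m i | ballot-below (ℕₚ.n<1+n m) (suc i) | ballot-below (ℕₚ.n<1+n m) i
        | ballot-below (ℕₚ.m<n⇒m<1+n (ℕₚ.n<1+n m)) i = ℕₚ.+-identityʳ _

-- With a, b, e standing for C(n, d - 1), C(n, d), C(n, d + 1), reflection gives the path count as
-- b² - a e, and absorption at two neighbouring indices turns n + 1 times this into (a + b)(b + e).
-- Adding (n + 1) a e to both sides keeps the computation in ℕ.
ballot-height-1 : ∀ n d → (suc n C d) ℕ.* (suc n C suc d) ≡ ballot n 1 (suc d) ℕ.* suc n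
ballot-height-1 n d = ℕₚ.+-cancelʳ-≡ (suc n ℕ.* (a ℕ.* e)) _ _ (begin
  (suc n C d) ℕ.* (suc n C suc d) ℕ.+ suc n ℕ.* (a ℕ.* e)
    ≡⟨ cong₂ (λ x y → x ℕ.* y ℕ.+ suc n ℕ.* (a ℕ.* e)) (pascal n (suc d)) (pascal n (2 ℕ.+ d)) ⟩
  (a ℕ.+ b) ℕ.* (b ℕ.+ e) ℕ.+ suc n ℕ.* (a ℕ.* e)
    ≡⟨ rearrange₁ n a b e ⟩
  (a ℕ.+ b) ℕ.* (b ℕ.+ e) ℕ.+ (suc n ℕ.* a) ℕ.* e
    ≡⟨ cong (λ x → (a ℕ.+ b) ℕ.* (b ℕ.+ e) ℕ.+ x ℕ.* e) (lower d) ⟨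
  (a ℕ.+ b) ℕ.* (b ℕ.+ e) ℕ.+ (d ℕ.* b ℕ.+ d ℕ.* a) ℕ.* e
    ≡⟨ rearrange₂ d a b e ⟩
  (a ℕ.* b ℕ.+ a ℕ.* (suc d ℕ.* e)) ℕ.+ (b ℕ.* b ℕ.+ suc d ℕ.* e ℕ.* b)
    ≡⟨ cong (ℕ._+ (b ℕ.* b ℕ.+ suc d ℕ.* e ℕ.* b)) square ⟨
  d ℕ.* (b ℕ.* b) ℕ.+ (b ℕ.* b ℕ.+ suc d ℕ.* e ℕ.* b)
    ≡⟨ rearrange₃ d b e ⟩
  b ℕ.* b ℕ.+ (suc d ℕ.* e ℕ.+ d ℕ.* b) ℕ.* b
    ≡⟨ cong (λ x → b ℕ.* b ℕ.+ x ℕ.* b) (absorption n d) ⟩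
  b ℕ.* b ℕ.+ (n ℕ.* b) ℕ.* b
    ≡⟨ rearrange₄ n b ⟩
  suc n ℕ.* (b ℕ.* b)
    ≡⟨ cong (suc n ℕ.*_) reflection ⟨
  suc n ℕ.* (t ℕ.+ a ℕ.* e)
    ≡⟨ rearrange₅ n t (a ℕ.* e) ⟩
  t ℕ.* suc n ℕ.+ suc n ℕ.* (a ℕ.* e) ∎)
  where
  a = binomial n (suc d)
  b = n C d
  e = n C suc d
  t = ballot n 1 (suc d)
  reflection : t ℕ.+ a ℕ.* e ≡ b ℕ.* b
  reflection = subst (λ i → t ℕ.+ a ℕ.* binomial n (suc (suc i)) ≡ b ℕ.* binomial n (suc i))
                     (ℕₚ.+-comm d 1) (ballot-reflection n 1 (suc d))
  -- Absorption one index lower: d C(n, d) = (n + 1 - d) C(n, d - 1). At d = 0 the padding makes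
  -- both sides 0.
  lower : ∀ d → d ℕ.* (n C d) ℕ.+ d ℕ.* binomial n (suc d) ≡ suc n ℕ.* binomial n (suc d)
  lower zero    = sym (ℕₚ.*-zeroʳ n)
  lower (suc d) = trans (shift d (n C d) (n C suc d)) (cong ((n C d) ℕ.+_) (absorption n d))
    where
    shift : ∀ d x y → suc d ℕ.* y ℕ.+ suc d ℕ.* x ≡ x ℕ.+ (suc d ℕ.* y ℕ.+ d ℕ.* x)
    shift = ℕ-RingSolver.solve-∀
  rearrange₁ : ∀ n a b e → (a ℕ.+ b) ℕ.* (b ℕ.+ e) ℕ.+ suc n ℕ.* (a ℕ.* e)
    ≡ (a ℕ.+ b) ℕ.* (b ℕ.+ e) ℕ.+ (suc n ℕ.* a) ℕ.* e
  rearrange₁ = ℕ-RingSolver.solve-∀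
  rearrange₂ : ∀ d a b e → (a ℕ.+ b) ℕ.* (b ℕ.+ e) ℕ.+ (d ℕ.* b ℕ.+ d ℕ.* a) ℕ.* e
    ≡ (a ℕ.* b ℕ.+ a ℕ.* (suc d ℕ.* e)) ℕ.+ (b ℕ.* b ℕ.+ suc d ℕ.* e ℕ.* b)
  rearrange₂ = ℕ-RingSolver.solve-∀
  rearrange₃ : ∀ d b e → d ℕ.* (b ℕ.* b) ℕ.+ (b ℕ.* b ℕ.+ suc d ℕ.* e ℕ.* b)
    ≡ b ℕ.* b ℕ.+ (suc d ℕ.* e ℕ.+ d ℕ.* b) ℕ.* b
  rearrange₃ = ℕ-RingSolver.solve-∀
  rearrange₄ : ∀ n b → b ℕ.* b ℕ.+ (n ℕ.* b) ℕ.* b ≡ suc n ℕ.* (b ℕ.* b)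
  rearrange₄ = ℕ-RingSolver.solve-∀
  rearrange₅ : ∀ n t x → suc n ℕ.* (t ℕ.+ x) ≡ t ℕ.* suc n ℕ.+ suc n ℕ.* x
  rearrange₅ = ℕ-RingSolver.solve-∀
  -- Both sides equal (n + 1 - d) a b; adding d a b avoids the subtraction.
  square : d ℕ.* (b ℕ.* b) ≡ a ℕ.* b ℕ.+ a ℕ.* (suc d ℕ.* e)
  square = ℕₚ.+-cancelʳ-≡ (d ℕ.* a ℕ.* b) _ _ (begin
    d ℕ.* (b ℕ.* b) ℕ.+ d ℕ.* a ℕ.* b                            ≡⟨ rearrange₆ d a b ⟩
    (d ℕ.* b ℕ.+ d ℕ.* a) ℕ.* b                                  ≡⟨ cong (ℕ._* b) (lower d) ⟩
    suc n ℕ.* a ℕ.* b                                            ≡⟨ rearrange₇ n a b ⟩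
    a ℕ.* b ℕ.+ a ℕ.* (n ℕ.* b)                                  ≡⟨ cong (λ x → a ℕ.* b ℕ.+ a ℕ.* x) (absorption n d) ⟨
    a ℕ.* b ℕ.+ a ℕ.* (suc d ℕ.* e ℕ.+ d ℕ.* b)                  ≡⟨ rearrange₈ d a b e ⟩
    a ℕ.* b ℕ.+ a ℕ.* (suc d ℕ.* e) ℕ.+ d ℕ.* a ℕ.* b            ∎)
    where
    rearrange₆ : ∀ d a b → d ℕ.* (b ℕ.* b) ℕ.+ d ℕ.* a ℕ.* b ≡ (d ℕ.* b ℕ.+ d ℕ.* a) ℕ.* b
    rearrange₆ = ℕ-RingSolver.solve-∀
    rearrange₇ : ∀ n a b → suc n ℕ.* a ℕ.* b ≡ a ℕ.* b ℕ.+ a ℕ.* (n ℕ.* b)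
    rearrange₇ = ℕ-RingSolver.solve-∀
    rearrange₈ : ∀ d a b e → a ℕ.* b ℕ.+ a ℕ.* (suc d ℕ.* e ℕ.+ d ℕ.* b)
      ≡ a ℕ.* b ℕ.+ a ℕ.* (suc d ℕ.* e) ℕ.+ d ℕ.* a ℕ.* b
    rearrange₈ = ℕ-RingSolver.solve-∀

-- Path polynomials and the moments C_(n+1)

fromℕ-ℚ : ℕ → ℚ
fromℕ-ℚ n = (ℤ.+ n) ℚ./ 1

fromℕ-ℚ-+ : ∀ m n → fromℕ-ℚ (m ℕ.+ n) ≡ fromℕ-ℚ m ℚ.+ fromℕ-ℚ n
fromℕ-ℚ-+ m n = ℚₚ.toℚᵘ-injective (begin-equality
  ℚ.toℚᵘ (fromℕ-ℚ (m ℕ.+ n))                       ≃⟨ ℚₚ.toℚᵘ-fromℚᵘ (ℚᵘ.mkℚᵘ (ℤ.+ (m ℕ.+ n)) 0) ⟩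
  ℚᵘ.mkℚᵘ (ℤ.+ (m ℕ.+ n)) 0                        ≃⟨ ℚᵘ.*≡* (numerators (ℤ.+ m) (ℤ.+ n)) ⟩
  ℚᵘ.mkℚᵘ (ℤ.+ m) 0 ℚᵘ.+ ℚᵘ.mkℚᵘ (ℤ.+ n) 0
    ≃⟨ ℚᵘₚ.+-cong (ℚₚ.toℚᵘ-fromℚᵘ (ℚᵘ.mkℚᵘ (ℤ.+ m) 0)) (ℚₚ.toℚᵘ-fromℚᵘ (ℚᵘ.mkℚᵘ (ℤ.+ n) 0)) ⟨
  ℚ.toℚᵘ (fromℕ-ℚ m) ℚᵘ.+ ℚ.toℚᵘ (fromℕ-ℚ n)       ≃⟨ ℚₚ.toℚᵘ-homo-+ (fromℕ-ℚ m) (fromℕ-ℚ n) ⟨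
  ℚ.toℚᵘ (fromℕ-ℚ m ℚ.+ fromℕ-ℚ n)                 ∎ℚᵘ)
  where
  open ℚᵘₚ.≤-Reasoning using (begin-equality_; step-≃-⟩; step-≃-⟨) renaming (_∎ to _∎ℚᵘ)
  numerators : ∀ x y → (x ℤ.+ y) ℤ.* ℤ.1ℤ ≡ (x ℤ.* ℤ.1ℤ ℤ.+ y ℤ.* ℤ.1ℤ) ℤ.* ℤ.1ℤ
  numerators = ℤ-RingSolver.solve-∀

-- The argument `suc d` undoes the shift of the degree in `ballot`; the shift of the height remains.
Ballot : ℕ → ℕ → Poly
Ballot n k d = fromℕ-ℚ (ballot n k (suc d))

Ballot-suc : ∀ n k → Ballot (suc n) (suc k) ≋
  Ballot n k + (Ballot n (suc k) + qP * (Ballot n (suc k) + Ballot n (2 ℕ.+ k)))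
Ballot-suc n k = mk λ d → trans (fromℕ-ℚ-+ (ballot n k (suc d)) _)
  (cong (Ballot n k d ℚ.+_) (trans (fromℕ-ℚ-+ (ballot n (suc k) (suc d)) _)
    (cong (Ballot n (suc k) d ℚ.+_) (shifted d))))
  where
  shifted : ∀ d → fromℕ-ℚ (ballot n (suc k) d ℕ.+ ballot n (2 ℕ.+ k) d)
                ≡ (qP * (Ballot n (suc k) + Ballot n (2 ℕ.+ k))) d
  -- The terms carrying q have no constant coefficient, which is the boundary value 0 of `ballot`.
  shifted zero    = sym (qP-*P-zero (Ballot n (suc k) + Ballot n (2 ℕ.+ k)))
  shifted (suc d) = trans (fromℕ-ℚ-+ (ballot n (suc k) (suc d)) (ballot n (2 ℕ.+ k) (suc d)))
                          (sym (qP-*P-suc (Ballot n (suc k) + Ballot n (2 ℕ.+ k)) d))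

Ballot-0 : ∀ n → Ballot n 0 ≋ 0#
Ballot-0 n = mk λ _ → refl

Ballot-below : ∀ {m j} → j < m → Ballot j (suc m) ≋ 0#
Ballot-below j<m = mk λ d → cong fromℕ-ℚ (ballot-below j<m (suc d))

Ballot-diagonal : ∀ m → Ballot m (suc m) ≋ 1#
Ballot-diagonal m = mk λ d → trans (cong fromℕ-ℚ (ballot-diagonal m d)) (unit d)
  where
  unit : ∀ d → fromℕ-ℚ (ballot 0 1 (suc d)) ≡ 1P d
  unit zero    = refl
  unit (suc d) = refl

-- Cross-multiplying the fraction in the Narayana coefficient leaves `ballot-height-1`.
Ballot-1 : ∀ n → Ballot n 1 ≋ Narayana (suc n)
Ballot-1 n = mk λ d → sym (ℚₚ.fromℚᵘ-cong
  {ℚᵘ.mkℚᵘ (ℤ.+ ((suc n C d) ℕ.* (suc n C suc d))) n} {ℚᵘ.mkℚᵘ (ℤ.+ ballot n 1 (suc d)) 0}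
  (ℚᵘ.*≡* (begin
    ℤ.+ ((suc n C d) ℕ.* (suc n C suc d)) ℤ.* ℤ.1ℤ   ≡⟨ ℤₚ.*-identityʳ _ ⟩
    ℤ.+ ((suc n C d) ℕ.* (suc n C suc d))            ≡⟨ cong ℤ.+_ (ballot-height-1 n d) ⟩
    ℤ.+ (ballot n 1 (suc d) ℕ.* suc n)               ≡⟨ ℤₚ.pos-* (ballot n 1 (suc d)) (suc n) ⟩
    ℤ.+ ballot n 1 (suc d) ℤ.* ℤ.+ suc n             ∎)))

-- Dyck prefixes and the moments C_n

-- Dyck prefixes of length 2 n ending at height 2 (k − 1), with down steps from even heights of weight q;
-- those of length 2 n + 1 ending at height 2 k − 1 are counted by Ballot n k.
EvenBallot : ℕ → ℕ → Poly
EvenBallot n       zero    = 0#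
EvenBallot zero    1       = 1#
EvenBallot zero    (suc k) = 0#
EvenBallot (suc n) (suc k) = Ballot n k + Ballot n (suc k)

-- The last step to height 2k + 1 is an up step from 2k or a down step of weight q from 2k + 2.
Ballot-EvenBallot : ∀ n k → Ballot n (suc k) ≋ EvenBallot n (suc k) + qP * EvenBallot n (2 ℕ.+ k)
Ballot-EvenBallot zero zero    = ≋-trans (Ballot-diagonal 0)
  (psolve 1 (λ q → con 1 ⊜ con 1 ⊕ q ⊗ con 0) ≋-refl qP)
Ballot-EvenBallot zero (suc k) = ≋-trans (Ballot-below {suc k} (s≤s z≤n))
  (psolve 1 (λ q → con 0 ⊜ con 0 ⊕ q ⊗ con 0) ≋-refl qP)
Ballot-EvenBallot (suc n) k    = ≋-trans (Ballot-suc n k)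
  (psolve 4 (λ q x y z → x ⊕ (y ⊕ q ⊗ (y ⊕ z)) ⊜ (x ⊕ y) ⊕ q ⊗ (y ⊕ z)) ≋-refl
    qP (Ballot n k) (Ballot n (suc k)) (Ballot n (2 ℕ.+ k)))

-- A nonempty Dyck path ends with a down step of weight 1 from height 1, which leads back to
-- `Ballot-1`.
EvenBallot-1 : ∀ n → EvenBallot n 1 ≋ Narayana n
EvenBallot-1 zero    = ≋-refl
EvenBallot-1 (suc n) = ≋-trans (+-congʳ {Ballot n 1} (Ballot-0 n)) (≋-trans (+-identityˡ (Ballot n 1)) (Ballot-1 n))

EvenBallot-below : ∀ {m j} → j < m → EvenBallot j (suc m) ≋ 0#
EvenBallot-below {suc m} {zero}  _         = ≋-refl
EvenBallot-below {suc m} {suc j} (s≤s j<m) =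
  ≋-trans (+-cong (Ballot-below j<m) (Ballot-below (ℕₚ.m<n⇒m<1+n j<m))) (+-identityˡ 0#)

EvenBallot-diagonal : ∀ m → EvenBallot m (suc m) ≋ 1#
EvenBallot-diagonal zero    = ≋-refl
EvenBallot-diagonal (suc m) =
  ≋-trans (+-cong (Ballot-diagonal m) (Ballot-below (ℕₚ.n<1+n m))) (+-identityʳ 1#)

-- Reduced rows and the two Narayana determinants

module Scaled (X : ℕ → ℕ → Poly) where

  -- The factor q^m absorbs the weight of the down step, so that the next row enters the recurrence
  -- with coefficient 1, as `det-toeplitz` requires.
  scaled : ℕ → ℕ → Poly
  scaled zero    j = 0#
  scaled (suc m) j = (qP ^P m) * X j (suc m)

  q*scaled : (∀ j → X j 0 ≋ 0#) → ∀ m j → qP * scaled m j ≋ (qP ^P m) * X j m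
  q*scaled X0 zero    j = ≋-trans (zeroʳ qP) (≋-sym (≋-trans (*-congˡ {1#} (X0 j)) (zeroʳ 1#)))
  q*scaled X0 (suc m) j = ≋-sym (*-assoc qP (qP ^P m) (X j (suc m)))

  scaled-1 : ∀ j → scaled 1 j ≋ X j 1
  scaled-1 j = *-identityˡ (X j 1)

  scaled-below : (∀ {m j} → j < m → X j (suc m) ≋ 0#) → ∀ {m j} → j < m → scaled (suc m) j ≋ 0#
  scaled-below below {m} j<m = ≋-trans (*-congˡ {qP ^P m} (below j<m)) (zeroʳ (qP ^P m))

  scaled-diagonal : (∀ m → X m (suc m) ≋ 1#) → ∀ m → scaled (suc m) m ≋ qP ^P m
  scaled-diagonal diagonal m = ≋-trans (*-congˡ {qP ^P m} (diagonal m)) (*-identityʳ (qP ^P m))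

open Scaled

scaled-Ballot-suc : ∀ m j → scaled Ballot (1 ℕ.+ m) (1 ℕ.+ j) ≋
  scaled Ballot (2 ℕ.+ m) j + ((1# + qP) * scaled Ballot (1 ℕ.+ m) j + qP * scaled Ballot m j)
scaled-Ballot-suc m j = begin≋
  p * Ballot (suc j) (suc m)
    ≈⟨ *-congˡ {p} (Ballot-suc j m) ⟩
  p * (x + (y + qP * (y + z)))
    ≈⟨ psolve 5 (λ q p x y z → p ⊗ (x ⊕ (y ⊕ q ⊗ (y ⊕ z))) ⊜ (q ⊗ p) ⊗ z ⊕ ((con 1 ⊕ q) ⊗ (p ⊗ y) ⊕ p ⊗ x)) ≋-refl qP p x y z ⟩
  (qP * p) * z + ((1# + qP) * (p * y) + p * x)
    ≈⟨ +-congˡ {(qP * p) * z} (+-congˡ {(1# + qP) * (p * y)} (q*scaled Ballot Ballot-0 m j)) ⟨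
  (qP * p) * z + ((1# + qP) * (p * y) + qP * scaled Ballot m j) ∎≋
  where
  p = qP ^P m
  x = Ballot j m
  y = Ballot j (suc m)
  z = Ballot j (2 ℕ.+ m)

-- Two Dyck steps that return to the same even height go up and down, with weight 1, or down and up,
-- with weight q; the latter is impossible at height 0.
even-level : ℕ → Poly
even-level zero    = 1#
even-level (suc m) = 1# + qP

scaled-EvenBallot-suc : ∀ m j → scaled EvenBallot (1 ℕ.+ m) (1 ℕ.+ j) ≋
  scaled EvenBallot (2 ℕ.+ m) j + (even-level m * scaled EvenBallot (1 ℕ.+ m) j + qP * scaled EvenBallot m j)
scaled-EvenBallot-suc zero j = begin≋
  1# * (Ballot j 0 + Ballot j 1)
    ≈⟨ *-congˡ {1#} (+-cong (Ballot-0 j) (Ballot-EvenBallot j 0)) ⟩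
  1# * (0# + (y + qP * z))
    ≈⟨ psolve 3 (λ q y z → con 1 ⊗ (con 0 ⊕ (y ⊕ q ⊗ z)) ⊜ (q ⊗ con 1) ⊗ z ⊕ (con 1 ⊗ (con 1 ⊗ y) ⊕ q ⊗ con 0)) ≋-refl qP y z ⟩
  (qP * 1#) * z + (1# * (1# * y) + qP * 0#) ∎≋
  where
  y = EvenBallot j 1
  z = EvenBallot j 2
scaled-EvenBallot-suc (suc m) j = begin≋
  (qP * p) * (Ballot j (suc m) + Ballot j (2 ℕ.+ m))
    ≈⟨ *-congˡ {qP * p} (+-cong (Ballot-EvenBallot j m) (Ballot-EvenBallot j (suc m))) ⟩
  (qP * p) * ((x + qP * y) + (y + qP * z))
    ≈⟨ psolve 5 (λ q p x y z → (q ⊗ p) ⊗ ((x ⊕ q ⊗ y) ⊕ (y ⊕ q ⊗ z))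
         ⊜ (q ⊗ (q ⊗ p)) ⊗ z ⊕ ((con 1 ⊕ q) ⊗ ((q ⊗ p) ⊗ y) ⊕ q ⊗ (p ⊗ x))) ≋-refl qP p x y z ⟩
  (qP * (qP * p)) * z + ((1# + qP) * ((qP * p) * y) + qP * (p * x)) ∎≋
  where
  p = qP ^P m
  x = EvenBallot j (suc m)
  y = EvenBallot j (2 ℕ.+ m)
  z = EvenBallot j (3 ℕ.+ m)

det-toeplitz-Narayana-suc : ∀ n → det n (toeplitz (Narayana ∘ suc) n) ≋ (- qP) ^P (n C 2)
det-toeplitz-Narayana-suc = det-toeplitz (Narayana ∘ suc) (scaled Ballot) (λ _ → 1# + qP) qP
  (λ _ → ≋-refl) (λ j → ≋-trans (scaled-1 Ballot j) (Ballot-1 j)) scaled-Ballot-suc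
  (scaled-below Ballot Ballot-below) (scaled-diagonal Ballot Ballot-diagonal)

det-toeplitz-Narayana : ∀ n → det n (toeplitz Narayana n) ≋ (- qP) ^P (n C 2)
det-toeplitz-Narayana = det-toeplitz Narayana (scaled EvenBallot) even-level qP
  (λ _ → ≋-refl) (λ j → ≋-trans (scaled-1 EvenBallot j) (EvenBallot-1 j)) scaled-EvenBallot-suc
  (scaled-below EvenBallot EvenBallot-below) (scaled-diagonal EvenBallot EvenBallot-diagonal)

-- Jacobi-Trudi matrices of rectangles

suc-rev-+ : ∀ {n} (i : Fin n) → suc (rev i ℕ.+ toℕ i) ≡ n
suc-rev-+ {suc n} zero    = cong suc (ℕₚ.+-identityʳ n)
suc-rev-+ {suc n} (suc i) = cong suc (trans (ℕₚ.+-suc (rev i) (toℕ i)) (suc-rev-+ i))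

-- By hypothesis a - i is the natural number s + `rev i`, so no entry falls into the negative case
-- of `hA`. The offset s is 1 for k^k and 0 for (k-1)^k.
sA-rect : ∀ n a s → (∀ (i : Fin n) → a ≡ (s ℕ.+ rev i) ℕ.+ toℕ i) →
  sA (rect n a) ≋ det n (toeplitz (λ j → Narayana (s ℕ.+ j)) n)
sA-rect n a s index = det-cong n λ i j → reflexive (cong hA (begin
  (ℤ.+ lookup (rect n a) i ℤ.- ℤ.+ toℕ i) ℤ.+ ℤ.+ toℕ j
    ≡⟨ cong (λ x → (ℤ.+ x ℤ.- ℤ.+ toℕ i) ℤ.+ ℤ.+ toℕ j) (trans (lookup-replicate i a) (index i)) ⟩
  ((ℤ.+ (s ℕ.+ rev i) ℤ.+ ℤ.+ toℕ i) ℤ.- ℤ.+ toℕ i) ℤ.+ ℤ.+ toℕ j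
    ≡⟨ cancel (ℤ.+ (s ℕ.+ rev i)) (ℤ.+ toℕ i) (ℤ.+ toℕ j) ⟩
  ℤ.+ ((s ℕ.+ rev i) ℕ.+ toℕ j)
    ≡⟨ cong ℤ.+_ (ℕₚ.+-assoc s (rev i) (toℕ j)) ⟩
  ℤ.+ (s ℕ.+ (rev i ℕ.+ toℕ j)) ∎))
  where
  cancel : ∀ x y z → ((x ℤ.+ y) ℤ.- y) ℤ.+ z ≡ x ℤ.+ z
  cancel = ℤ-RingSolver.solve-∀

theorem7 : (k : ℕ) → k ≥ 1 →
    (sA (rect k k) ≈ ((-P qP) ^P (k C 2)))
    × (sA (rect k (k ∸ 1)) ≈ ((-P qP) ^P (k C 2)))
theorem7 k _ =
    at (≋-trans (sA-rect k k 1 (λ i → sym (suc-rev-+ i))) (det-toeplitz-Narayana-suc k))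
  , at (≋-trans (sA-rect k (k ∸ 1) 0 (λ i → cong (_∸ 1) (sym (suc-rev-+ i)))) (det-toeplitz-Narayana k))
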